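{- Let $q$ be a prime power and let $n, t$ be positive integers. Let $S$ be a subset of the points of $\mathrm{PG}(n,q)$ such that any line in $\mathrm{PG}(n,q)$ intersects $S$ in at most $t$ points. Then the graph $\Gamma_{S,n,q}$ is $\{C_4, \theta_{3,t}\}$-free.
   Context: $\mathrm{PG}(n,q)$ denotes the projective space of (projective) dimension $n$ over the finite field $\mathbb{F}_q$. Given a set $S$ of points of $\mathrm{PG}(n,q)$, embed $\mathrm{PG}(n,q)$ as a hyperplane of $\mathrm{PG}(n+1,q)$. The linear representation of $S$ is the point-line geometry whose points are all the points of $\mathrm{PG}(n+1,q) \setminus \mathrm{PG}(n,q)$ and whose lines are all the lines of $\mathrm{PG}(n+1,q)$ which intersect $\mathrm{PG}(n,q)$ in precisely one point, namely a point of $S$. The graph $\Gamma_{S,n,q}$ is the point-line incidence graph of this geometry: it is the bipartite graph whose two parts are the points and the lines of the linear representation of $S$, with a point adjacent to a line if and only if the point lies on the line. A graph is $\mathcal{F}$-free if it contains no graph in $\mathcal{F}$ as a (not necessarily induced) subgraph. $C_4$ is the cycle of length 4. $\theta_{3,t}$ is the theta graph consisting of two vertices joined by $t$ internally vertex-disjoint paths, each with exactly 3 edges. -}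

module Defs where

open import Algebra.Bundles using (CommutativeRing)
open import Algebra.Module.Bundles using (Module)
open import Algebra.Module.Morphism.Structures using (IsModuleMonomorphism)
open import Algebra.Module.Structures.Biased using (IsModuleFromLeft)
import Algebra.Definitions.RawMonoid as MonoidSum
open import Data.Fin.Base using (Fin; suc)
open import Data.Fin.Patterns using (0F; 1F; 2F; 3F)
open import Data.List.Base using (List; length)
open import Data.List.Relation.Unary.All using (All)
import Data.List.Relation.Unary.Unique.Setoid as UniqueList
open import Data.Nat.Base as ℕ using (ℕ; suc; _≤_; NonZero)
open import Data.Nat.Primality using (Prime)
open import Data.Product.Base using (Σ; ∃; ∃₂; _×_; _,_; proj₁; proj₂)
open import Data.Sum.Base using (inj₁; inj₂)
open import Data.Sum.Relation.Binary.Pointwise using (_⊎ₛ_; inj₁; inj₂)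
open import Data.Vec.Functional using (Vector)
import Data.Vec.Functional.Relation.Binary.Equality.Setoid as VectorEquality
open import Function.Base using (_∘_)
open import Function.Bundles using (Inverse; Injection)
open import Level using (Level; _⊔_; 0ℓ) renaming (suc to lsuc)
open import Relation.Binary.Bundles using (Setoid)
open import Relation.Binary.Core using (Rel)
open import Relation.Binary.Definitions using (Symmetric; Irreflexive; _Respects_; _Respects₂_)
import Relation.Binary.Construct.On as On
open import Relation.Binary.Construct.Closure.Symmetric using (SymClosure; fwd; bwd; symmetric)
open import Relation.Binary.PropositionalEquality using (_≡_; refl; setoid; resp₂)
open import Relation.Nullary.Negation using (¬_)
open import Relation.Unary using (Pred)

private
  variable
    a b e a′ b′ e′ i s c ℓ m ℓm m′ ℓm′ : Level

------------------------------------------------------------------------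
-- Graphs

record Graph a b e : Set (lsuc (a ⊔ b ⊔ e)) where
  field
    vertices   : Setoid a b
  open Setoid vertices renaming (Carrier to Vertex) public
  field
    Adj        : Rel Vertex e
    Adj-sym    : Symmetric Adj
    Adj-irrefl : Irreflexive _≈_ Adj
    Adj-resp   : Adj Respects₂ _≈_

-- The graph whose edges are those of E with their orientation forgotten.
fromEdges : (V : Setoid a b) (E : Rel (Setoid.Carrier V) e) →
            Irreflexive (Setoid._≈_ V) E → E Respects₂ (Setoid._≈_ V) → Graph a b e
fromEdges V E irrefl resp = record
  { vertices   = V
  ; Adj        = SymClosure E
  ; Adj-sym    = symmetric E
  ; Adj-irrefl = λ { x≈y (fwd xy) → irrefl x≈y xy
                   ; x≈y (bwd yx) → irrefl (sym x≈y) yx }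
  ; Adj-resp   = (λ { y≈z (fwd xy) → fwd (proj₁ resp y≈z xy)
                    ; y≈z (bwd yx) → bwd (proj₂ resp y≈z yx) })
               , (λ { y≈z (fwd yx) → fwd (proj₂ resp y≈z yx)
                    ; y≈z (bwd xy) → bwd (proj₁ resp y≈z xy) })
  }
  where open Setoid V

-- H is a (not necessarily induced) subgraph of G, up to isomorphism.
_⊑_ : Graph a b e → Graph a′ b′ e′ → Set _
H ⊑ G = Σ (Injection (Graph.vertices H) (Graph.vertices G)) λ f →
        ∀ {u v} → Graph.Adj H u v → Graph.Adj G (Injection.to f u) (Injection.to f v)

_IsFree_ : Graph a b e → List (Graph a′ b′ e′) → Set _
G IsFree 𝓕 = All (λ H → ¬ (H ⊑ G)) 𝓕

data C₄-Edge : Rel (Fin 4) 0ℓ where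
  01-edge : C₄-Edge 0F 1F
  12-edge : C₄-Edge 1F 2F
  23-edge : C₄-Edge 2F 3F
  30-edge : C₄-Edge 3F 0F

C₄ : Graph 0ℓ 0ℓ 0ℓ
C₄ = fromEdges (setoid (Fin 4)) C₄-Edge (λ { refl () }) (resp₂ C₄-Edge)

-- The i-th path of θ₃ t is  start — first i — second i — end.
data θ₃-Vertex (t : ℕ) : Set where
  start end    : θ₃-Vertex t
  first second : Fin t → θ₃-Vertex t

data θ₃-Edge (t : ℕ) : Rel (θ₃-Vertex t) 0ℓ where
  start-first  : ∀ i → θ₃-Edge t start (first i)
  first-second : ∀ i → θ₃-Edge t (first i) (second i)
  second-end   : ∀ i → θ₃-Edge t (second i) end

θ₃ : ℕ → Graph 0ℓ 0ℓ 0ℓ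
θ₃ t = fromEdges (setoid (θ₃-Vertex t)) (θ₃-Edge t) (λ { refl () }) (resp₂ (θ₃-Edge t))

module _ (P : Setoid a b) (L : Setoid a′ b′) where

  private
    module P = Setoid P
    module L = Setoid L
    module PL = Setoid (P ⊎ₛ L)

  data Flag (_I_ : P.Carrier → L.Carrier → Set i) : Rel PL.Carrier (a ⊔ a′ ⊔ i) where
    flag : ∀ {p l} → p I l → Flag _I_ (inj₁ p) (inj₂ l)

  incidenceGraph : (_I_ : P.Carrier → L.Carrier → Set i) →
                   (∀ {p p′ l l′} → p P.≈ p′ → l L.≈ l′ → p I l → p′ I l′) →
                   Graph _ _ _
  incidenceGraph _I_ I-resp = fromEdges (P ⊎ₛ L) (Flag _I_)
    (λ { () (flag _) })
    ( (λ { (inj₂ l≈l′) (flag pIl) → flag (I-resp P.refl l≈l′ pIl) })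
    , (λ { (inj₁ p≈p′) (flag pIl) → flag (I-resp p≈p′ L.refl pIl) }) )

------------------------------------------------------------------------
-- Finite fields

IsPrimePower : ℕ → Set
IsPrimePower q = ∃₂ λ p k → Prime p × NonZero k × q ≡ p ℕ.^ k

record FiniteField (q : ℕ) c ℓ : Set (lsuc (c ⊔ ℓ)) where
  field
    commutativeRing : CommutativeRing c ℓ
  open CommutativeRing commutativeRing using (Carrier; _≈_; _≉_; _*_; 0#; 1#)
  field
    0≉1     : 0# ≉ 1#
    inverse : ∀ x → x ≉ 0# → ∃ λ y → x * y ≈ 1#
    card    : Inverse (CommutativeRing.setoid commutativeRing) (setoid (Fin q))

------------------------------------------------------------------------
-- Subspaces

module _ {R : CommutativeRing c ℓ} (M : Module R m ℓm) where

  open CommutativeRing R using (Carrier; _≈_; 0#)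
  open Module M

  linearCombination : ∀ {k} → Vector Carrier k → Vector Carrierᴹ k → Carrierᴹ
  linearCombination λs vs = MonoidSum.sum +ᴹ-rawMonoid (λ i → λs i *ₗ vs i)

  LinearlyIndependent : ∀ {k} → Vector Carrierᴹ k → Set _
  LinearlyIndependent vs = ∀ λs → linearCombination λs vs ≈ᴹ 0ᴹ → ∀ i → λs i ≈ 0#

  -- A k-dimensional linear subspace is presented by a basis; two
  -- presentations are identified (by _≋_ below) when their spans coincide.
  record Subspace (k : ℕ) : Set (c ⊔ ℓ ⊔ m ⊔ ℓm) where
    field
      basis       : Vector Carrierᴹ k
      independent : LinearlyIndependent basis

module _ {R : CommutativeRing c ℓ} {M : Module R m ℓm} where

  open Module M

  infix 4 _∈ˢ_ _⊆_ _≋_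

  _∈ˢ_ : ∀ {k} → Carrierᴹ → Subspace M k → Set _
  v ∈ˢ U = ∃ λ λs → linearCombination M λs (Subspace.basis U) ≈ᴹ v

  _⊆_ : ∀ {j k} → Subspace M j → Subspace M k → Set _
  U ⊆ W = ∀ {v} → v ∈ˢ U → v ∈ˢ W

  _≋_ : ∀ {k} → Subspace M k → Subspace M k → Set _
  U ≋ W = U ⊆ W × W ⊆ U

  subspaces : ℕ → Setoid _ _
  subspaces k = record
    { Carrier       = Subspace M k
    ; _≈_           = _≋_
    ; isEquivalence = record
      { refl  = (λ v∈ → v∈) , (λ v∈ → v∈)
      ; sym   = λ (f , g) → g , f
      ; trans = λ (f , g) (f′ , g′) → (λ v∈ → f′ (f v∈)) , (λ v∈ → g (g′ v∈))
      }
    }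

record Monomorphism {R : CommutativeRing c ℓ} (M : Module R m ℓm) (N : Module R m′ ℓm′)
                    : Set (c ⊔ m ⊔ m′ ⊔ ℓm ⊔ ℓm′) where
  field
    to : Module.Carrierᴹ M → Module.Carrierᴹ N
    isModuleMonomorphism :
      IsModuleMonomorphism (Module.rawModule M) (Module.rawModule N) to
  open IsModuleMonomorphism isModuleMonomorphism public

module _ {R : CommutativeRing c ℓ} {M : Module R m ℓm} {N : Module R m′ ℓm′}
         (ι : Monomorphism M N) where

  private
    module M = Module M
    module N = Module N
    module ι = Monomorphism ι

  map-linearCombination : ∀ {k} λs (vs : Vector M.Carrierᴹ k) →
    ι.to (linearCombination M λs vs) N.≈ᴹ linearCombination N λs (ι.to ∘ vs)
  map-linearCombination {ℕ.zero} λs vs = ι.0ᴹ-homo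
  map-linearCombination {suc k}  λs vs = N.≈ᴹ-trans (ι.+ᴹ-homo _ _)
    (N.+ᴹ-cong (ι.*ₗ-homo _ _) (map-linearCombination (λs ∘ suc) (vs ∘ suc)))

  image : ∀ {k} → Subspace M k → Subspace N k
  image U = record
    { basis       = ι.to ∘ basis
    ; independent = λ λs Σ≈0 → independent λs (ι.injective
        (N.≈ᴹ-trans (map-linearCombination λs basis)
        (N.≈ᴹ-trans Σ≈0 (N.≈ᴹ-sym ι.0ᴹ-homo))))
    }
    where open Subspace U

coordinateSpace : (R : CommutativeRing c ℓ) → ℕ → Module R c ℓ
coordinateSpace R d = record
  { Carrierᴹ = Vector Carrier d
  ; _≈ᴹ_     = _≈ᵛ_
  ; _+ᴹ_     = λ u v i → u i + v i
  ; _*ₗ_     = λ r v i → r * v i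
  ; _*ᵣ_     = λ v r i → r * v i
  ; 0ᴹ       = λ _ → 0#
  ; -ᴹ_      = λ v i → - v i
  ; isModule = IsModuleFromLeft.isModule {commutativeRing = R} (record
    { isLeftModule = record
      { isLeftSemimodule = record
        { +ᴹ-isCommutativeMonoid = record
          { isMonoid = record
            { isSemigroup = record
              { isMagma = record
                { isEquivalence = ≋-isEquivalence d
                ; ∙-cong = λ u≈ v≈ i → +-cong (u≈ i) (v≈ i)
                }
              ; assoc = λ u v w i → +-assoc (u i) (v i) (w i)
              }
            ; identity = (λ v i → +-identityˡ (v i)) , (λ v i → +-identityʳ (v i))
            }
          ; comm = λ u v i → +-comm (u i) (v i)
          }
        ; isPreleftSemimodule = record
          { *ₗ-cong      = λ r≈ v≈ i → *-cong r≈ (v≈ i)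
          ; *ₗ-zeroˡ     = λ v i → zeroˡ (v i)
          ; *ₗ-distribʳ  = λ v r s i → distribʳ (v i) r s
          ; *ₗ-identityˡ = λ v i → *-identityˡ (v i)
          ; *ₗ-assoc     = λ r s v i → *-assoc r s (v i)
          ; *ₗ-zeroʳ     = λ r i → zeroʳ r
          ; *ₗ-distribˡ  = λ r u v i → distribˡ r (u i) (v i)
          }
        }
      ; -ᴹ‿cong    = λ v≈ i → -‿cong (v≈ i)
      ; -ᴹ‿inverse = (λ v i → -‿inverseˡ (v i)) , (λ v i → -‿inverseʳ (v i))
      }
    })
  }
  where
  open CommutativeRing R renaming (setoid to R-setoid)
  open VectorEquality R-setoid using (≋-isEquivalence) renaming (_≋_ to _≈ᵛ_)

------------------------------------------------------------------------
-- Projective geometry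

-- Cardinality bound counting elements up to the setoid equality.
AtMost : (A : Setoid a b) → ℕ → Pred (Setoid.Carrier A) s → Set _
AtMost A t Q = ∀ xs → UniqueList.Unique A xs → All Q xs → length xs ≤ t

module PG {q : ℕ} (F : FiniteField q c ℓ) (n : ℕ) where

  space : Module (FiniteField.commutativeRing F) c ℓ
  space = coordinateSpace (FiniteField.commutativeRing F) (suc n)

  Point Line : Set (c ⊔ ℓ)
  Point = Subspace space 1
  Line  = Subspace space 2

  points lines : Setoid (c ⊔ ℓ) (c ⊔ ℓ)
  points = subspaces {M = space} 1
  lines  = subspaces {M = space} 2

  record PointSet s : Set (c ⊔ ℓ ⊔ lsuc s) where
    field
      Member : Pred Point s
      resp   : Member Respects (_≋_ {M = space})

-- The image has dimension n+1 in a space of dimension n+2, so it is a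
-- hyperplane of PG(n+1,q); no particular choice of hyperplane is fixed.
HyperplaneEmbedding : ∀ {q} → FiniteField q c ℓ → ℕ → Set (c ⊔ ℓ)
HyperplaneEmbedding F n = Monomorphism (PG.space F n) (PG.space F (suc n))

module LinearRepresentation {q} (F : FiniteField q c ℓ) (n : ℕ)
  (ι : HyperplaneEmbedding F n) (S : PG.PointSet F n s) where

  private
    module Π = PG F n
    module Ω = PG F (suc n)
    module S = Π.PointSet S

  -- image ι P is the point P of PG(n,q), seen as a point of PG(n+1,q).
  AffinePoint : Set (c ⊔ ℓ)
  AffinePoint = Σ Ω.Point λ X → ∀ P → ¬ (X ≋ image ι P)

  IsGeometryLine : Pred Ω.Line (c ⊔ ℓ ⊔ s)
  IsGeometryLine L = Σ Π.Point λ P →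
    S.Member P × image ι P ⊆ L × (∀ Q → image ι Q ⊆ L → Q ≋ P)

  GeometryLine : Set (c ⊔ ℓ ⊔ s)
  GeometryLine = Σ Ω.Line IsGeometryLine

  Γ : Graph (c ⊔ ℓ ⊔ s) (c ⊔ ℓ ⊔ s) (c ⊔ ℓ ⊔ s)
  Γ = incidenceGraph
    (On.setoid {B = AffinePoint} Ω.points proj₁)
    (On.setoid {B = GeometryLine} Ω.lines proj₁)
    (λ X L → proj₁ X ⊆ proj₁ L)
    (λ (_ , X′⊆X) (L⊆L′ , _) X⊆L x∈X′ → L⊆L′ (X⊆L (X′⊆X x∈X′)))

{-# OPTIONS --safe #-}
module Submission where

-- Two affine points lie on at most one common line, which excludes C₄.  Suppose that
-- θ₃ t joins an affine point X to a line M by paths X — Lᵢ — Yᵢ — M.  All Lᵢ lie in the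
-- plane spanned by M and one of the Lᵢ, so their points at infinity, and that of M, lie
-- on the line at infinity of this plane.  Equal points at infinity would make two lines
-- through X, or through some Yᵢ, coincide; so that line carries t + 1 points of S.

open import Defs
open import Algebra.Bundles using (CommutativeRing)
open import Algebra.Module.Bundles using (Module)
import Algebra.Definitions.RawMonoid as MonoidSum
import Algebra.Module.Properties as ModuleProperties
import Algebra.Properties.CommutativeMonoid.Sum as CommutativeMonoidSum
import Algebra.Properties.Group as GroupProperties
import Algebra.Properties.Ring as RingProperties
open import Data.Empty using (⊥)
open import Data.Fin.Base using (Fin; zero; suc)
open import Data.Fin.Patterns using (0F; 1F; 2F; 3F)
import Data.Fin.Properties as Fin
open import Data.List.Base using ([]; _∷_; tabulate)
open import Data.List.Properties using (length-tabulate)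
open import Data.List.Relation.Unary.All using ([]; _∷_)
import Data.List.Relation.Unary.All.Properties as All
import Data.List.Relation.Unary.AllPairs as AllPairs
import Data.List.Relation.Unary.Unique.Setoid.Properties as Unique
open import Data.Nat.Base using (ℕ; suc; NonZero)
open import Data.Nat.Properties using (1+n≰n; ≤-reflexive; ≤-trans)
open import Data.Product.Base using (∃; _×_; _,_; proj₁; proj₂)
open import Data.Sum.Base using (inj₁; inj₂)
open import Data.Sum.Relation.Binary.Pointwise using (inj₁; inj₂)
open import Data.Vec.Functional using (Vector) renaming ([] to []ᵛ; _∷_ to _∷ᵛ_)
open import Function.Base using (_∘_; case_of_)
open import Function.Bundles using (Injection)
open import Function.Properties.Inverse using (Inverse⇒Injection)
open import Level using (Level)
open import Relation.Binary.Construct.Closure.Symmetric using (fwd; bwd)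
open import Relation.Binary.Definitions using (Decidable)
open import Relation.Binary.PropositionalEquality as ≡ using (_≡_; refl; cong; subst; subst₂)
import Relation.Binary.Reasoning.Setoid as SetoidReasoning
open import Relation.Nullary.Decidable using (via-injection; decidable-stable)
open import Relation.Nullary.Negation using (¬_)

private
  variable
    c ℓ m ℓm m′ ℓm′ s : Level

-- Linear combinations and spans

module _ {R : CommutativeRing c ℓ} (M : Module R m ℓm) where

  open CommutativeRing R hiding (zero; refl)
  open Module M
  open CommutativeMonoidSum +ᴹ-commutativeMonoid using (sum-cong-≋; ∑-distrib-+; sum-replicate-zero)
  open SetoidReasoning ≈ᴹ-setoid

  private
    lc : ∀ {k} → Vector Carrier k → Vector Carrierᴹ k → Carrierᴹ
    lc = linearCombination M

  linearCombination-congʳ : ∀ {k} (λs : Vector Carrier k) {vs ws : Vector Carrierᴹ k} →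
    (∀ i → vs i ≈ᴹ ws i) → linearCombination M λs vs ≈ᴹ linearCombination M λs ws
  linearCombination-congʳ λs vs≈ws = sum-cong-≋ (λ i → *ₗ-congˡ {x = λs i} (vs≈ws i))

  linearCombination-zero : ∀ {k} {λs : Vector Carrier k} (vs : Vector Carrierᴹ k) →
    (∀ i → λs i ≈ 0#) → linearCombination M λs vs ≈ᴹ 0ᴹ
  linearCombination-zero {k} vs λs≈0 = ≈ᴹ-trans
    (sum-cong-≋ (λ i → ≈ᴹ-trans (*ₗ-congʳ (λs≈0 i)) (*ₗ-zeroˡ (vs i))))
    (sum-replicate-zero k)

  linearCombination-+ : ∀ {k} (λs μs : Vector Carrier k) (vs : Vector Carrierᴹ k) →
    linearCombination M (λ i → λs i + μs i) vs ≈ᴹ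
    linearCombination M λs vs +ᴹ linearCombination M μs vs
  linearCombination-+ λs μs vs = ≈ᴹ-trans
    (sum-cong-≋ (λ i → *ₗ-distribʳ (vs i) (λs i) (μs i)))
    (∑-distrib-+ (λ i → λs i *ₗ vs i) (λ i → μs i *ₗ vs i))

  linearCombination-* : ∀ {k} r (λs : Vector Carrier k) (vs : Vector Carrierᴹ k) →
    linearCombination M (λ i → r * λs i) vs ≈ᴹ r *ₗ linearCombination M λs vs
  linearCombination-* {ℕ.zero} r λs vs = ≈ᴹ-sym (*ₗ-zeroʳ r)
  linearCombination-* {suc k}  r λs vs = begin
    (r * λs zero) *ₗ vs zero +ᴹ lc (λ i → r * λs (suc i)) (vs ∘ suc)
      ≈⟨ +ᴹ-cong (*ₗ-assoc _ _ _) (linearCombination-* r (λs ∘ suc) (vs ∘ suc)) ⟩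
    r *ₗ (λs zero *ₗ vs zero) +ᴹ r *ₗ lc (λs ∘ suc) (vs ∘ suc)
      ≈⟨ *ₗ-distribˡ r _ _ ⟨
    r *ₗ lc λs vs ∎

  -- Substituting combinations into a combination multiplies the row `μs` by the matrix `A`. The new
  -- coefficients stay raw sums, so that for matrices of a fixed size they unfold by computation.
  linearCombination-assoc : ∀ {j k} (μs : Vector Carrier j) (A : Fin j → Vector Carrier k)
    (vs : Vector Carrierᴹ k) →
    linearCombination M μs (λ i → linearCombination M (A i) vs) ≈ᴹ
    linearCombination M (λ l → MonoidSum.sum +-rawMonoid (λ i → μs i * A i l)) vs
  linearCombination-assoc {ℕ.zero} μs A vs =
    ≈ᴹ-sym (linearCombination-zero vs (λ _ → CommutativeRing.refl R))
  linearCombination-assoc {suc j}  μs A vs = begin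
    μs zero *ₗ lc (A zero) vs +ᴹ lc (μs ∘ suc) (λ i → lc (A (suc i)) vs)
      ≈⟨ +ᴹ-cong (≈ᴹ-sym (linearCombination-* (μs zero) (A zero) vs))
                 (linearCombination-assoc (μs ∘ suc) (A ∘ suc) vs) ⟩
    lc (λ l → μs zero * A zero l) vs +ᴹ
    lc (λ l → MonoidSum.sum +-rawMonoid (λ i → μs (suc i) * A (suc i) l)) vs
      ≈⟨ linearCombination-+ _ _ vs ⟨
    lc (λ l → MonoidSum.sum +-rawMonoid (λ i → μs i * A i l)) vs ∎

  linearCombination-unit : ∀ {k} (vs : Vector Carrierᴹ k) i →
    ∃ λ λs → linearCombination M λs vs ≈ᴹ vs i
  linearCombination-unit vs zero = (1# ∷ᵛ λ _ → 0#) , (begin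
    1# *ₗ vs zero +ᴹ lc (λ _ → 0#) (vs ∘ suc)
      ≈⟨ +ᴹ-cong (*ₗ-identityˡ _) (linearCombination-zero (vs ∘ suc) (λ _ → CommutativeRing.refl R)) ⟩
    vs zero +ᴹ 0ᴹ ≈⟨ +ᴹ-identityʳ _ ⟩
    vs zero       ∎)
  linearCombination-unit vs (suc i) with linearCombination-unit (vs ∘ suc) i
  ... | λs , eq = (0# ∷ᵛ λs) , (begin
    0# *ₗ vs zero +ᴹ lc λs (vs ∘ suc) ≈⟨ +ᴹ-cong (*ₗ-zeroˡ _) eq ⟩
    0ᴹ +ᴹ vs (suc i)                  ≈⟨ +ᴹ-identityˡ _ ⟩
    vs (suc i)                        ∎)

module _ {R : CommutativeRing c ℓ} {M : Module R m ℓm} where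

  open CommutativeRing R hiding (zero; refl)
  open Module M

  ∈ˢ-resp : ∀ {k} {U : Subspace M k} {v w} → v ≈ᴹ w → v ∈ˢ U → w ∈ˢ U
  ∈ˢ-resp v≈w (λs , eq) = λs , ≈ᴹ-trans eq v≈w

  basis-∈ˢ : ∀ {k} (U : Subspace M k) i → Subspace.basis U i ∈ˢ U
  basis-∈ˢ U = linearCombination-unit M (Subspace.basis U)

  *ₗ-∈ˢ : ∀ {k} {U : Subspace M k} r {v} → v ∈ˢ U → r *ₗ v ∈ˢ U
  *ₗ-∈ˢ {U = U} r (λs , eq) =
    (λ i → r * λs i) , ≈ᴹ-trans (linearCombination-* M r λs (Subspace.basis U)) (*ₗ-congˡ eq)

  linearCombination-∈ˢ : ∀ {j k} {U : Subspace M k} (μs : Vector Carrier j) {vs} →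
    (∀ i → vs i ∈ˢ U) → linearCombination M μs vs ∈ˢ U
  linearCombination-∈ˢ {U = U} μs vs∈U = _ , ≈ᴹ-trans
    (≈ᴹ-sym (linearCombination-assoc M μs (proj₁ ∘ vs∈U) (Subspace.basis U)))
    (linearCombination-congʳ M μs (proj₂ ∘ vs∈U))

  basis-∈ˢ⇒⊆ : ∀ {j k} {U : Subspace M j} {W : Subspace M k} →
    (∀ i → Subspace.basis U i ∈ˢ W) → U ⊆ W
  basis-∈ˢ⇒⊆ {W = W} basis∈W (λs , eq) =
    ∈ˢ-resp {U = W} eq (linearCombination-∈ˢ {U = W} λs basis∈W)

  -- Row `i` of `A` holds the coordinates of the `i`-th basis vector of `U` in the basis of `W`.
  -- This turns an inclusion into a matrix on which determinants can be used.
  ⊆⇒coordinates : ∀ {j k} {U : Subspace M j} {W : Subspace M k} → U ⊆ W →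
    ∃ λ (A : Fin j → Vector Carrier k) → ∀ μs →
      linearCombination M μs (Subspace.basis U) ≈ᴹ
      linearCombination M (λ l → MonoidSum.sum +-rawMonoid (λ i → μs i * A i l)) (Subspace.basis W)
  ⊆⇒coordinates {U = U} {W} U⊆W = proj₁ ∘ basis∈W , λ μs → ≈ᴹ-trans
    (≈ᴹ-sym (linearCombination-congʳ M μs (proj₂ ∘ basis∈W)))
    (linearCombination-assoc M μs (proj₁ ∘ basis∈W) (Subspace.basis W))
    where
    basis∈W : ∀ i → Subspace.basis U i ∈ˢ W
    basis∈W i = U⊆W (basis-∈ˢ U i)

-- Subspaces and their images under a monomorphism

module _ {R : CommutativeRing c ℓ} {M : Module R m ℓm} {N : Module R m′ ℓm′}
         (ι : Monomorphism M N) where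

  private
    module M = Module M
    module N = Module N
    module ι = Monomorphism ι

  ∈ˢ⇒to-∈ˢ : ∀ {k} {U : Subspace M k} {v} → v ∈ˢ U → ι.to v ∈ˢ image ι U
  ∈ˢ⇒to-∈ˢ {U = U} (λs , eq) =
    λs , N.≈ᴹ-trans (N.≈ᴹ-sym (map-linearCombination ι λs (Subspace.basis U))) (ι.⟦⟧-cong eq)

  image-∈ˢ⁻ : ∀ {k} {U : Subspace M k} {w} → w ∈ˢ image ι U → ∃ λ v → v ∈ˢ U × ι.to v N.≈ᴹ w
  image-∈ˢ⁻ {U = U} (λs , eq) = _ , (λs , M.≈ᴹ-refl) ,
    N.≈ᴹ-trans (map-linearCombination ι λs (Subspace.basis U)) eq

  to-∈ˢ⇒∈ˢ : ∀ {k} {U : Subspace M k} {v} → ι.to v ∈ˢ image ι U → v ∈ˢ U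
  to-∈ˢ⇒∈ˢ {U = U} (λs , eq) =
    λs , ι.injective (N.≈ᴹ-trans (map-linearCombination ι λs (Subspace.basis U)) eq)

  image-mono : ∀ {j k} {U : Subspace M j} {W : Subspace M k} → U ⊆ W → image ι U ⊆ image ι W
  image-mono {U = U} {W} U⊆W = basis-∈ˢ⇒⊆ {U = image ι U} {W = image ι W}
    (λ i → ∈ˢ⇒to-∈ˢ {U = W} (U⊆W (basis-∈ˢ U i)))

-- Points and lines over a finite field

module _ {q} (F : FiniteField q c ℓ) where

  open FiniteField F using (commutativeRing; card; inverse; 0≉1)
  open CommutativeRing commutativeRing hiding (zero)
  open RingProperties ring using (-‿distribˡ-*; -0#≈0#; -‿involutive)

  infix 4 _≟_

  -- Equality in `F` is decided through the bijection with `Fin q`. This justifies the later proofs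
  -- by contradiction that a coefficient vanishes.
  _≟_ : Decidable _≈_
  _≟_ = via-injection (Inverse⇒Injection card) Fin._≟_

  module _ {M : Module commutativeRing m ℓm} where

    open Module M
    open ModuleProperties M using (inverseˡ-uniqueᴹ; x≈0⇒x*y≈0)
    open SetoidReasoning ≈ᴹ-setoid

    *ₗ-inverse : ∀ {r} → r ≉ 0# → ∃ λ r⁻¹ → ∀ v → r⁻¹ *ₗ (r *ₗ v) ≈ᴹ v
    *ₗ-inverse {r} r≉0 with inverse r r≉0
    ... | r⁻¹ , rr⁻¹≈1 = r⁻¹ , λ v → begin
      r⁻¹ *ₗ (r *ₗ v) ≈⟨ *ₗ-assoc r⁻¹ r v ⟨
      (r⁻¹ * r) *ₗ v  ≈⟨ *ₗ-congʳ (trans (*-comm r⁻¹ r) rr⁻¹≈1) ⟩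
      1# *ₗ v         ≈⟨ *ₗ-identityˡ v ⟩
      v               ∎

    *ₗ-cancel-∈ˢ : ∀ {k} {U : Subspace M k} {r v} → r ≉ 0# → r *ₗ v ∈ˢ U → v ∈ˢ U
    *ₗ-cancel-∈ˢ {U = U} {v = v} r≉0 rv∈U with *ₗ-inverse r≉0
    ... | r⁻¹ , r⁻¹r≈1 = ∈ˢ-resp {U = U} (r⁻¹r≈1 v) (*ₗ-∈ˢ {U = U} r⁻¹ rv∈U)

    adjoin : ∀ {k} v (U : Subspace M k) → ¬ (v ∈ˢ U) → Subspace M (suc k)
    adjoin v U v∉U = record
      { basis       = v ∷ᵛ Subspace.basis U
      ; independent = independent
      }
      where
      independent : LinearlyIndependent M (v ∷ᵛ Subspace.basis U)
      independent λs Σ≈0 = λ { zero → λ₀≈0 ; (suc i) → Subspace.independent U (λs ∘ suc) rest≈0 i }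
        where
        rest : Carrierᴹ
        rest = linearCombination M (λs ∘ suc) (Subspace.basis U)
        λ₀≈0 : λs zero ≈ 0#
        -- The relation gives `λs zero *ₗ v ≈ - rest`, a vector of `U`; dividing by a nonzero
        -- `λs zero` would put `v` in `U`. The negative is written `- 1# *ₗ rest` so that `*ₗ-∈ˢ`
        -- applies.
        λ₀≈0 = decidable-stable (λs zero ≟ 0#) λ λ₀≉0 → v∉U (*ₗ-cancel-∈ˢ {U = U} λ₀≉0
          (∈ˢ-resp {U = U} (begin
            - 1# *ₗ rest        ≈⟨ inverseˡ-uniqueᴹ _ _ (begin
              - 1# *ₗ rest +ᴹ rest       ≈⟨ +ᴹ-congˡ (*ₗ-identityˡ rest) ⟨
              - 1# *ₗ rest +ᴹ 1# *ₗ rest ≈⟨ *ₗ-distribʳ rest (- 1#) 1# ⟨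
              (- 1# + 1#) *ₗ rest        ≈⟨ x≈0⇒x*y≈0 (-‿inverseˡ 1#) ⟩
              0ᴹ ∎) ⟩
            -ᴹ rest             ≈⟨ inverseˡ-uniqueᴹ _ _ Σ≈0 ⟨
            λs zero *ₗ v        ∎)
          (*ₗ-∈ˢ {U = U} (- 1#) (λs ∘ suc , ≈ᴹ-refl))))
        rest≈0 : rest ≈ᴹ 0ᴹ
        rest≈0 = begin
          rest                 ≈⟨ +ᴹ-identityˡ rest ⟨
          0ᴹ +ᴹ rest           ≈⟨ +ᴹ-congʳ (x≈0⇒x*y≈0 λ₀≈0) ⟨
          λs zero *ₗ v +ᴹ rest ≈⟨ Σ≈0 ⟩
          0ᴹ                   ∎

    module _ {k} {v} {U : Subspace M k} (v∉U : ¬ (v ∈ˢ U)) where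

      ∈ˢ-adjoin : v ∈ˢ adjoin v U v∉U
      ∈ˢ-adjoin = basis-∈ˢ (adjoin v U v∉U) zero

      ⊆-adjoin : U ⊆ adjoin v U v∉U
      ⊆-adjoin = basis-∈ˢ⇒⊆ {U = U} {adjoin v U v∉U} (basis-∈ˢ (adjoin v U v∉U) ∘ suc)

      adjoin-⊆ : ∀ {j} {W : Subspace M j} → v ∈ˢ W → U ⊆ W → adjoin v U v∉U ⊆ W
      adjoin-⊆ {W = W} v∈W U⊆W = basis-∈ˢ⇒⊆ {U = adjoin v U v∉U} {W}
        λ { zero → v∈W ; (suc i) → U⊆W (basis-∈ˢ U i) }

    generator : Subspace M 1 → Carrierᴹ
    generator X = Subspace.basis X zero

    generator-∈ˢ : (X : Subspace M 1) → generator X ∈ˢ X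
    generator-∈ˢ X = basis-∈ˢ X zero

    generator-∈ˢ⇒⊆ : ∀ {k} {X : Subspace M 1} {W : Subspace M k} → generator X ∈ˢ W → X ⊆ W
    generator-∈ˢ⇒⊆ {X = X} {W} x∈W = basis-∈ˢ⇒⊆ {U = X} {W} λ { zero → x∈W }

    *ₗ-generator : (X : Subspace M 1) → ∀ r → r *ₗ generator X ≈ᴹ 0ᴹ → r ≈ 0#
    *ₗ-generator X r rx≈0 =
      Subspace.independent X (λ _ → r) (≈ᴹ-trans (+ᴹ-identityʳ _) rx≈0) zero

    -- The generator of `X` is a multiple of the generator of `Y`. The factor is nonzero, since by
    -- independence a generator is not the zero vector, and dividing by it gives the reverse
    -- inclusion.
    point-⊆⇒⊇ : {X Y : Subspace M 1} → X ⊆ Y → Y ⊆ X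
    point-⊆⇒⊇ {X} {Y} X⊆Y with X⊆Y (generator-∈ˢ X)
    ... | λs , eq = generator-∈ˢ⇒⊆ {X = Y} {X} (*ₗ-cancel-∈ˢ {U = X} λ₀≉0
          (∈ˢ-resp {U = X} (≈ᴹ-sym λ₀y≈x) (generator-∈ˢ X)))
      where
      λ₀y≈x : λs zero *ₗ generator Y ≈ᴹ generator X
      λ₀y≈x = ≈ᴹ-trans (≈ᴹ-sym (+ᴹ-identityʳ _)) eq
      λ₀≉0 : λs zero ≉ 0#
      λ₀≉0 λ₀≈0 = 0≉1 (sym (*ₗ-generator X 1# (begin
        1# *ₗ generator X        ≈⟨ *ₗ-identityˡ _ ⟩
        generator X              ≈⟨ λ₀y≈x ⟨
        λs zero *ₗ generator Y   ≈⟨ x≈0⇒x*y≈0 λ₀≈0 ⟩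
        0ᴹ                       ∎)))

    -- Cramer's rule: det *ₗ wⱼ lies in U for each basis vector wⱼ of W, while
    -- det ≈ 0 would turn the cofactors into vanishing combinations of a basis of U.
    line-⊆⇒⊇ : {U W : Subspace M 2} → U ⊆ W → W ⊆ U
    line-⊆⇒⊇ {U} {W} U⊆W with ⊆⇒coordinates {U = U} {W} U⊆W
    ... | A , coordinates = basis-∈ˢ⇒⊆ {U = W} {U}
          λ { 0F → *ₗ-cancel-∈ˢ {U = U} det≉0 (cofactor₀ , cofactor₀-eq)
            ; 1F → *ₗ-cancel-∈ˢ {U = U} det≉0 (cofactor₁ , cofactor₁-eq) }
      where
      a b a′ b′ det : Carrier
      a = A 0F 0F
      b = A 0F 1F
      a′ = A 1F 0F
      b′ = A 1F 1F
      -- The order of the factors and the final `+ 0#` are those of the sum that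
      -- `coordinates cofactor₀` produces.
      det = b′ * a + (- b * a′ + 0#)

      -- These are the rows of the adjugate of the matrix with rows `(a, b)` and `(a′, b′)`.
      cofactor₀ cofactor₁ : Vector Carrier 2
      cofactor₀ = b′ ∷ᵛ - b ∷ᵛ []ᵛ
      cofactor₁ = - a′ ∷ᵛ a ∷ᵛ []ᵛ

      cancel : ∀ x y → x * y + (- y * x + 0#) ≈ 0#
      cancel x y = trans (+-congˡ (trans (+-identityʳ _)
        (trans (sym (-‿distribˡ-* y x)) (-‿cong (*-comm y x))))) (-‿inverseʳ (x * y))

      cofactor₀-eq : linearCombination M cofactor₀ (Subspace.basis U) ≈ᴹ det *ₗ Subspace.basis W 0F
      cofactor₀-eq = begin
        linearCombination M cofactor₀ (Subspace.basis U) ≈⟨ coordinates cofactor₀ ⟩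
        det *ₗ Subspace.basis W 0F +ᴹ ((b′ * b + (- b * b′ + 0#)) *ₗ Subspace.basis W 1F +ᴹ 0ᴹ)
          ≈⟨ +ᴹ-congˡ (≈ᴹ-trans (+ᴹ-identityʳ _) (x≈0⇒x*y≈0 (cancel b′ b))) ⟩
        det *ₗ Subspace.basis W 0F +ᴹ 0ᴹ ≈⟨ +ᴹ-identityʳ _ ⟩
        det *ₗ Subspace.basis W 0F ∎

      minor≈0 : - a′ * a + (a * a′ + 0#) ≈ 0#
      minor≈0 = trans (+-congˡ (+-identityʳ _))
        (trans (+-congʳ (trans (sym (-‿distribˡ-* a′ a)) (-‿cong (*-comm a′ a)))) (-‿inverseˡ (a * a′)))

      minor≈det : - a′ * b + (a * b′ + 0#) ≈ det
      minor≈det = trans (+-cong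
          (trans (sym (-‿distribˡ-* a′ b)) (trans (-‿cong (*-comm a′ b)) (-‿distribˡ-* b a′)))
          (trans (+-identityʳ _) (*-comm a b′)))
        (trans (+-comm _ _) (+-congˡ (sym (+-identityʳ _))))

      cofactor₁-eq : linearCombination M cofactor₁ (Subspace.basis U) ≈ᴹ det *ₗ Subspace.basis W 1F
      cofactor₁-eq = begin
        linearCombination M cofactor₁ (Subspace.basis U) ≈⟨ coordinates cofactor₁ ⟩
        (- a′ * a + (a * a′ + 0#)) *ₗ Subspace.basis W 0F +ᴹ
          ((- a′ * b + (a * b′ + 0#)) *ₗ Subspace.basis W 1F +ᴹ 0ᴹ)
          ≈⟨ +ᴹ-cong (x≈0⇒x*y≈0 minor≈0) (≈ᴹ-trans (+ᴹ-identityʳ _) (*ₗ-congʳ minor≈det)) ⟩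
        0ᴹ +ᴹ det *ₗ Subspace.basis W 1F ≈⟨ +ᴹ-identityˡ _ ⟩
        det *ₗ Subspace.basis W 1F ∎

      det≉0 : det ≉ 0#
      -- Independence of the basis of `U` makes the entries `a` and `- b` of the cofactors vanish.
      -- Then the first basis vector of `U`, which is `a`, `b` in coordinates, is zero, against
      -- independence once more.
      det≉0 det≈0 = 0≉1 (sym (Subspace.independent U (1# ∷ᵛ 0# ∷ᵛ []ᵛ)
        (≈ᴹ-trans (coordinates (1# ∷ᵛ 0# ∷ᵛ []ᵛ))
          (linearCombination-zero M (Subspace.basis W) row≈0)) 0F))
        where
        -x≈0⇒x≈0 : ∀ x → - x ≈ 0# → x ≈ 0#
        -x≈0⇒x≈0 x -x≈0 = trans (sym (-‿involutive x)) (trans (-‿cong -x≈0) -0#≈0#)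
        a≈0 : a ≈ 0#
        a≈0 = Subspace.independent U cofactor₁ (≈ᴹ-trans cofactor₁-eq (x≈0⇒x*y≈0 det≈0)) 1F
        b≈0 : b ≈ 0#
        b≈0 = -x≈0⇒x≈0 b
          (Subspace.independent U cofactor₀ (≈ᴹ-trans cofactor₀-eq (x≈0⇒x*y≈0 det≈0)) 1F)
        row₀≈0 : ∀ {x} y → x ≈ 0# → 1# * x + (0# * y + 0#) ≈ 0#
        row₀≈0 y x≈0 = trans (+-cong (trans (*-identityˡ _) x≈0)
          (trans (+-identityʳ _) (zeroˡ y))) (+-identityʳ 0#)
        row≈0 : ∀ l → 1# * A 0F l + (0# * A 1F l + 0#) ≈ 0#
        row≈0 0F = row₀≈0 a′ a≈0
        row≈0 1F = row₀≈0 b′ b≈0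

    -- The line joining two distinct points

    module _ {X Y : Subspace M 1} (X≉Y : ¬ (X ≋ Y)) where

      generator-∉ˢ : ¬ (generator X ∈ˢ Y)
      generator-∉ˢ x∈Y = X≉Y (X⊆Y , point-⊆⇒⊇ {X} {Y} X⊆Y)
        where
        X⊆Y : X ⊆ Y
        X⊆Y = generator-∈ˢ⇒⊆ {X = X} {Y} x∈Y

      join : Subspace M 2
      join = adjoin (generator X) Y generator-∉ˢ

      join-⊆ : ∀ {k} {W : Subspace M k} → X ⊆ W → Y ⊆ W → join ⊆ W
      join-⊆ {W = W} X⊆W Y⊆W =
        adjoin-⊆ {U = Y} generator-∉ˢ {W = W} (X⊆W (generator-∈ˢ X)) Y⊆W

      ⊆-joinˡ : X ⊆ join
      ⊆-joinˡ = generator-∈ˢ⇒⊆ {X = X} {join} (∈ˢ-adjoin {U = Y} generator-∉ˢ)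

      ⊆-joinʳ : Y ⊆ join
      ⊆-joinʳ = ⊆-adjoin {U = Y} generator-∉ˢ

      -- The join of `X` and `Y` lies in `L` and has the same dimension, so it is all of `L`; and it
      -- lies in every subspace through both points. The dimension of `W` is left free because
      -- planes are needed as well as lines.
      line-through-⊆ : ∀ {k} {L : Subspace M 2} {W : Subspace M k} →
        X ⊆ L → Y ⊆ L → X ⊆ W → Y ⊆ W → L ⊆ W
      line-through-⊆ {L = L} {W} X⊆L Y⊆L X⊆W Y⊆W v∈L =
        join-⊆ {W = W} X⊆W Y⊆W (line-⊆⇒⊇ {join} {L} (join-⊆ {W = L} X⊆L Y⊆L) v∈L)

      line-unique : {L L′ : Subspace M 2} →
        X ⊆ L → Y ⊆ L → X ⊆ L′ → Y ⊆ L′ → L ≋ L′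
      line-unique {L} {L′} X⊆L Y⊆L X⊆L′ Y⊆L′ =
        line-through-⊆ {L = L} {L′} X⊆L Y⊆L X⊆L′ Y⊆L′ ,
        line-through-⊆ {L = L′} {L} X⊆L′ Y⊆L′ X⊆L Y⊆L

-- Linear representations

module _ {q} {F : FiniteField q c ℓ} {n : ℕ} (ι : HyperplaneEmbedding F n) (S : PG.PointSet F n s) where

  open LinearRepresentation F n ι S

  private
    module S = PG.PointSet S
    module Γ = Graph Γ
    module ι = Monomorphism ι
    module Ω = Module (PG.space F (suc n))
    module K = CommutativeRing (FiniteField.commutativeRing F)
    Π = PG.space F n
    open Module Π using (Carrierᴹ; _*ₗ_; _+ᴹ_; -ᴹ_; +ᴹ-identityʳ; ≈ᴹ-sym; ≈ᴹ-trans)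

    infix 4 _I_ _≈ₚ_ _≈ₗ_

    _I_ : AffinePoint → GeometryLine → Set _
    X I L = proj₁ X ⊆ proj₁ L

    _≈ₚ_ : AffinePoint → AffinePoint → Set _
    X ≈ₚ Y = proj₁ X ≋ proj₁ Y

    _≈ₗ_ : GeometryLine → GeometryLine → Set _
    L ≈ₗ M = proj₁ L ≋ proj₁ M

    direction : GeometryLine → PG.Point F n
    direction (_ , P , _) = P

    direction-∈ : ∀ L → S.Member (direction L)
    direction-∈ (_ , _ , P∈S , _) = P∈S

    direction-⊆ : ∀ L → image ι (direction L) ⊆ proj₁ L
    direction-⊆ (_ , _ , _ , P⊆L , _) = P⊆L

  -- By definition an affine point differs only from embedded points. A preimage `v` of its
  -- generator would be nonzero and span a point `P` whose image is `X`.
  affine-∉ι : (X : AffinePoint) → ∀ v → ¬ (ι.to v Ω.≈ᴹ generator F (proj₁ X))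
  affine-∉ι (X , X∉Π) v ιv≈x = X∉Π P (X⊆P , point-⊆⇒⊇ F {X = X} {image ι P} X⊆P)
    where
    P : PG.Point F n
    P = record
      { basis       = λ _ → v
      ; independent = λ λs Σ≈0 → λ { 0F → *ₗ-generator F X (λs 0F)
          (Ω.≈ᴹ-trans (Ω.*ₗ-congˡ (Ω.≈ᴹ-sym ιv≈x))
          (Ω.≈ᴹ-trans (Ω.≈ᴹ-sym (ι.*ₗ-homo (λs 0F) v))
          (Ω.≈ᴹ-trans (ι.⟦⟧-cong (≈ᴹ-trans (≈ᴹ-sym (+ᴹ-identityʳ (λs 0F *ₗ v))) Σ≈0))
            ι.0ᴹ-homo))) }
      }
    X⊆P : X ⊆ image ι P
    X⊆P = generator-∈ˢ⇒⊆ F {X = X} {image ι P}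
      (∈ˢ-resp {U = image ι P} ιv≈x (basis-∈ˢ (image ι P) 0F))

  affine-∉ˢ : (X : AffinePoint) → ∀ {k} (U : Subspace Π k) → ¬ (generator F (proj₁ X) ∈ˢ image ι U)
  affine-∉ˢ X U x∈U with image-∈ˢ⁻ ι {U = U} x∈U
  ... | v , _ , ιv≈x = affine-∉ι X v ιv≈x

  -- The span of an affine point and `image ι U` meets the hyperplane in `image ι U` alone. If the
  -- coefficient of the generator `x` were nonzero, `x` would be a multiple of `ι.to (v - u)` and
  -- hence lie in the hyperplane.
  hyperplane-∩-adjoin : (X : AffinePoint) → ∀ {k} (U : Subspace Π k) {v} →
    ι.to v ∈ˢ adjoin F (generator F (proj₁ X)) (image ι U) (affine-∉ˢ X U) → v ∈ˢ U
  hyperplane-∩-adjoin X U {v} (λs , eq) = to-∈ˢ⇒∈ˢ ι {U = U} (λs ∘ suc , (begin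
    rest                   ≈⟨ Ω.+ᴹ-identityˡ rest ⟨
    Ω.0ᴹ Ω.+ᴹ rest         ≈⟨ Ω.+ᴹ-congʳ (x≈0⇒x*y≈0 λ₀≈0) ⟨
    λs 0F Ω.*ₗ x Ω.+ᴹ rest ≈⟨ eq ⟩
    ι.to v                 ∎))
    where
    open SetoidReasoning Ω.≈ᴹ-setoid
    open ModuleProperties (PG.space F (suc n)) using (x≈0⇒x*y≈0)
    open GroupProperties Ω.+ᴹ-group using (x≈z//y)
    x rest : Ω.Carrierᴹ
    x = generator F (proj₁ X)
    rest = linearCombination (PG.space F (suc n)) (λs ∘ suc) (ι.to ∘ Subspace.basis U)
    u w : Carrierᴹ
    u = linearCombination Π (λs ∘ suc) (Subspace.basis U)
    w = v +ᴹ -ᴹ u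
    ιw≈λ₀x : ι.to w Ω.≈ᴹ λs 0F Ω.*ₗ x
    ιw≈λ₀x = begin
      ι.to w                      ≈⟨ ι.+ᴹ-homo v (-ᴹ u) ⟩
      ι.to v Ω.+ᴹ ι.to (-ᴹ u)     ≈⟨ Ω.+ᴹ-congˡ (ι.-ᴹ-homo u) ⟩
      ι.to v Ω.+ᴹ Ω.-ᴹ ι.to u
        ≈⟨ Ω.+ᴹ-congˡ (Ω.-ᴹ‿cong (map-linearCombination ι (λs ∘ suc) (Subspace.basis U))) ⟩
      ι.to v Ω.+ᴹ Ω.-ᴹ rest       ≈⟨ x≈z//y _ rest _ eq ⟨
      λs 0F Ω.*ₗ x                ∎
    λ₀≈0 : λs 0F K.≈ K.0#
    λ₀≈0 = decidable-stable (_≟_ F (λs 0F) K.0#) λ λ₀≉0 →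
      let r , r-inverse = *ₗ-inverse F {M = PG.space F (suc n)} λ₀≉0
      in affine-∉ι X (r *ₗ w) (begin
        ι.to (r *ₗ w)              ≈⟨ ι.*ₗ-homo r w ⟩
        r Ω.*ₗ ι.to w              ≈⟨ Ω.*ₗ-congˡ ιw≈λ₀x ⟩
        r Ω.*ₗ (λs 0F Ω.*ₗ x)      ≈⟨ r-inverse x ⟩
        x                          ∎)

  -- Both lines join the affine point `X` to the same point at infinity, and these two points are
  -- distinct.
  geometryLine-unique : ∀ X {L M} → X I L → X I M → direction L ≋ direction M → L ≈ₗ M
  geometryLine-unique (X , X∉Π) {L} {M} X⊆L X⊆M (P⊆Q , _) =
    line-unique F {X = X} {image ι P} (X∉Π P)
      {proj₁ L} {proj₁ M} X⊆L (direction-⊆ L) X⊆M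
      (λ x∈P → direction-⊆ M (image-mono ι {U = P} {Q} P⊆Q x∈P))
    where
    P = direction L
    Q = direction M

  -- `Λ` joins the directions of `L 0F` and `M`. These two lines meet in `Y 0F`, so both lie in the
  -- plane of `Y 0F` and `Λ`. Each `L i` joins `X` on `L 0F` to `Y i` on `M`, hence lies in this
  -- plane, whose points at infinity are those of `Λ`.
  θ₃-paths-collinear : ∀ {t X M} (L : Fin (suc t) → GeometryLine) (Y : Fin (suc t) → AffinePoint) →
    (∀ i → X I L i) → (∀ i → Y i I L i) → (∀ i → Y i I M) →
    (∀ i → ¬ (X ≈ₚ Y i)) → (∀ i → ¬ (L i ≈ₗ M)) →
    ∃ λ (Λ : PG.Line F n) → direction M ⊆ Λ × (∀ i → direction (L i) ⊆ Λ)
  θ₃-paths-collinear {t} {X} {M} L Y XIL YIL YIM X≉Y L≉M = Λ , ⊆-joinʳ F {X = P 0F} {P₀} P≉P₀ , P⊆Λ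
    where
    P₀ : PG.Point F n
    P₀ = direction M
    P : Fin (suc t) → PG.Point F n
    P = direction ∘ L
    P≉P₀ : ¬ (P 0F ≋ P₀)
    P≉P₀ P≋P₀ = L≉M 0F (geometryLine-unique (Y 0F) {L 0F} {M} (YIL 0F) (YIM 0F) P≋P₀)
    Λ : PG.Line F n
    Λ = join F {X = P 0F} {P₀} P≉P₀
    y : Ω.Carrierᴹ
    y = generator F (proj₁ (Y 0F))
    -- The plane is built over its line at infinity, not from `L 0F` and `M`, so that
    -- `hyperplane-∩-adjoin` applies to it directly.
    plane : Subspace (PG.space F (suc n)) 3
    plane = adjoin F y (image ι Λ) (affine-∉ˢ (Y 0F) Λ)
    Λ⊆plane : image ι Λ ⊆ plane
    Λ⊆plane = ⊆-adjoin F {U = image ι Λ} (affine-∉ˢ (Y 0F) Λ)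
    Y₀⊆plane : proj₁ (Y 0F) ⊆ plane
    Y₀⊆plane = generator-∈ˢ⇒⊆ F {X = proj₁ (Y 0F)} {plane}
      (∈ˢ-adjoin F {U = image ι Λ} (affine-∉ˢ (Y 0F) Λ))
    geometryLine-⊆plane : ∀ K → Y 0F I K → direction K ⊆ Λ → proj₁ K ⊆ plane
    geometryLine-⊆plane K Y₀IN Q⊆Λ =
      line-through-⊆ F {X = proj₁ (Y 0F)} {image ι Q} (proj₂ (Y 0F) Q) {L = proj₁ K} {plane}
        Y₀IN (direction-⊆ K) Y₀⊆plane (λ v∈Q → Λ⊆plane (image-mono ι {U = Q} {Λ} Q⊆Λ v∈Q))
      where
      Q : PG.Point F n
      Q = direction K
    M⊆plane : proj₁ M ⊆ plane
    M⊆plane = geometryLine-⊆plane M (YIM 0F) (⊆-joinʳ F {X = P 0F} {P₀} P≉P₀)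
    L₀⊆plane : proj₁ (L 0F) ⊆ plane
    L₀⊆plane = geometryLine-⊆plane (L 0F) (YIL 0F) (⊆-joinˡ F {X = P 0F} {P₀} P≉P₀)
    L⊆plane : ∀ i → proj₁ (L i) ⊆ plane
    -- The index 0 needs no separate case: `X` enters the plane through `L 0F` and `Y i` through
    -- `M`, for every `i`.
    L⊆plane i = line-through-⊆ F {X = proj₁ X} {proj₁ (Y i)} (X≉Y i) {L = proj₁ (L i)} {plane}
      (XIL i) (YIL i) (λ x∈X → L₀⊆plane (XIL 0F x∈X)) (λ y∈Y → M⊆plane (YIM i y∈Y))
    P⊆Λ : ∀ i → P i ⊆ Λ
    P⊆Λ i = generator-∈ˢ⇒⊆ F {X = P i} {Λ} (hyperplane-∩-adjoin (Y 0F) Λ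
      (L⊆plane i (direction-⊆ (L i) (∈ˢ⇒to-∈ˢ ι {U = P i} (generator-∈ˢ F (P i))))))

  -- From adjacency to incidence, and the exclusion of `C₄`

  neighbour-of-point : ∀ {X v} → Γ.Adj (inj₁ X) v → ∃ λ L → v ≡ inj₂ L × X I L
  neighbour-of-point (fwd (flag XIL)) = _ , refl , XIL

  neighbour-of-line : ∀ {L v} → Γ.Adj (inj₂ L) v → ∃ λ X → v ≡ inj₁ X × X I L
  neighbour-of-line (bwd (flag XIL)) = _ , refl , XIL

  -- Sides alternate along a walk, so three edges starting at a line end at a point.
  no-three-walk : ∀ {L y l M} → Γ.Adj (inj₂ L) y → Γ.Adj y l → Γ.Adj l (inj₂ M) → ⊥
  no-three-walk (bwd (flag _)) (fwd (flag _)) (fwd ())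
  no-three-walk (bwd (flag _)) (fwd (flag _)) (bwd ())

  adjacent⇒incident : ∀ {u v X L} → u ≡ inj₁ X → v ≡ inj₂ L → Γ.Adj u v → X I L
  adjacent⇒incident refl refl (fwd (flag XIL)) = XIL

  no-square : ∀ {X Y L M} → X I L → X I M → Y I L → Y I M →
    ¬ (X ≈ₚ Y) → ¬ (L ≈ₗ M) → ⊥
  no-square {X} {Y} {L} {M} XIL XIM YIL YIM X≉Y L≉M = L≉M
    (line-unique F {X = proj₁ X} {proj₁ Y} X≉Y {proj₁ L} {proj₁ M} XIL YIL XIM YIM)

  C₄-free : ¬ (C₄ ⊑ Γ)
  C₄-free (f , adj) = cycle (to 0F) (to 1F) (to 2F) (to 3F)
    (adj {0F} {1F} (fwd 01-edge)) (adj {1F} {2F} (fwd 12-edge))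
    (adj {2F} {3F} (fwd 23-edge)) (adj {3F} {0F} (fwd 30-edge))
    (λ eq → case injective {0F} {2F} eq of λ ()) (λ eq → case injective {1F} {3F} eq of λ ())
    where
    open Injection f using (to; injective)
    -- The vertices become variables so that their sides can be matched on. Only the two alternating
    -- patterns survive, and each needs just the distinctness of opposite vertices.
    cycle : ∀ u₀ u₁ u₂ u₃ → Γ.Adj u₀ u₁ → Γ.Adj u₁ u₂ → Γ.Adj u₂ u₃ → Γ.Adj u₃ u₀ →
      ¬ (u₀ Γ.≈ u₂) → ¬ (u₁ Γ.≈ u₃) → ⊥
    cycle (inj₁ X) (inj₂ L) (inj₁ Y) (inj₂ M)
      (fwd (flag XIL)) (bwd (flag YIL)) (fwd (flag YIM)) (bwd (flag XIM)) u₀≉u₂ u₁≉u₃ =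
      no-square {X} {Y} {L} {M} XIL XIM YIL YIM (u₀≉u₂ ∘ inj₁) (u₁≉u₃ ∘ inj₂)
    cycle (inj₂ L) (inj₁ X) (inj₂ M) (inj₁ Y)
      (bwd (flag XIL)) (fwd (flag XIM)) (bwd (flag YIM)) (fwd (flag YIL)) u₀≉u₂ u₁≉u₃ =
      no-square {X} {Y} {L} {M} XIL XIM YIL YIM (u₁≉u₃ ∘ inj₁) (u₀≉u₂ ∘ inj₂)

  -- Exclusion of the theta graph

  module _ {t : ℕ} (S-lines : ∀ (Λ : PG.Line F n) →
             AtMost (PG.points F n) (suc t) (λ P → S.Member P × P ⊆ Λ)) where

    no-θ₃-geometry : ∀ {X M} (L : Fin (suc t) → GeometryLine) (Y : Fin (suc t) → AffinePoint) →
      (∀ i → X I L i) → (∀ i → Y i I L i) → (∀ i → Y i I M) →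
      (∀ i → ¬ (X ≈ₚ Y i)) → (∀ i → ¬ (L i ≈ₗ M)) →
      (∀ {i j} → L i ≈ₗ L j → i ≡ j) → ⊥
    -- The directions of the lines `L i` number `suc t`, which the bound still allows; the direction
    -- of `M` is the one point too many.
    no-θ₃-geometry {X} {M} L Y XIL YIL YIM X≉Y L≉M L-injective = 1+n≰n (≤-trans
      (≤-reflexive (cong suc (≡.sym (length-tabulate P))))
      (S-lines (proj₁ collinear) (direction M ∷ tabulate P)
        (All.tabulate⁺ {f = P} P₀≉P AllPairs.∷
          Unique.tabulate⁺ (PG.points F n) {f = P} (λ {i} {j} → P-injective {i} {j}))
        ((direction-∈ M , proj₁ (proj₂ collinear)) ∷
          All.tabulate⁺ {f = P} (λ i → direction-∈ (L i) , proj₂ (proj₂ collinear) i))))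
      where
      collinear : ∃ λ (Λ : PG.Line F n) → direction M ⊆ Λ × (∀ i → direction (L i) ⊆ Λ)
      collinear = θ₃-paths-collinear {X = X} {M} L Y XIL YIL YIM X≉Y L≉M
      P : Fin (suc t) → PG.Point F n
      P = direction ∘ L
      P₀≉P : ∀ i → ¬ (direction M ≋ P i)
      P₀≉P i (P₀⊆P , P⊆P₀) =
        L≉M i (geometryLine-unique (Y i) {L i} {M} (YIL i) (YIM i) (P⊆P₀ , P₀⊆P))
      P-injective : ∀ {i j} → P i ≋ P j → i ≡ j
      P-injective {i} {j} P≋P =
        L-injective (geometryLine-unique X {L i} {L j} (XIL i) (XIL j) P≋P)

    -- Starting from a point, alternation of sides forces `ls` to consist of lines, `ys` of points,
    -- and `v` to be a line. These vertices are known only up to propositional equality, so the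
    -- hypotheses are transported along those equations.
    no-θ₃-from-point : ∀ X v (ls ys : Fin (suc t) → Γ.Vertex) →
      (∀ i → Γ.Adj (inj₁ X) (ls i)) → (∀ i → Γ.Adj (ls i) (ys i)) → (∀ i → Γ.Adj (ys i) v) →
      (∀ {i j} → ls i Γ.≈ ls j → i ≡ j) →
      (∀ i → ¬ (inj₁ X Γ.≈ ys i)) → (∀ i → ¬ (ls i Γ.≈ v)) → ⊥
    no-θ₃-from-point X v ls ys X~ls ls~ys ys~v ls-injective X≉ys ls≉v =
      no-θ₃-geometry {X} {M} L Y XIL
        (λ i → adjacent⇒incident (ys≡ i) (ls≡ i) (Γ.Adj-sym (ls~ys i)))
        (λ i → adjacent⇒incident (ys≡ i) v≡M (ys~v i))
        (λ i X≈Y → X≉ys i (subst (inj₁ X Γ.≈_) (≡.sym (ys≡ i)) (inj₁ X≈Y)))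
        (λ i L≈M → ls≉v i (subst₂ Γ._≈_ (≡.sym (ls≡ i)) (≡.sym v≡M) (inj₂ L≈M)))
        (λ {i} {j} L≈L → ls-injective (subst₂ Γ._≈_ (≡.sym (ls≡ i)) (≡.sym (ls≡ j)) (inj₂ L≈L)))
      where
      L : Fin (suc t) → GeometryLine
      L i = proj₁ (neighbour-of-point (X~ls i))
      ls≡ : ∀ i → ls i ≡ inj₂ (L i)
      ls≡ i = proj₁ (proj₂ (neighbour-of-point (X~ls i)))
      XIL : ∀ i → X I L i
      XIL i = proj₂ (proj₂ (neighbour-of-point (X~ls i)))
      L~ys : ∀ i → ∃ λ Y → ys i ≡ inj₁ Y × Y I L i
      L~ys i = neighbour-of-line (subst (λ l → Γ.Adj l (ys i)) (ls≡ i) (ls~ys i))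
      Y : Fin (suc t) → AffinePoint
      Y i = proj₁ (L~ys i)
      ys≡ : ∀ i → ys i ≡ inj₁ (Y i)
      ys≡ i = proj₁ (proj₂ (L~ys i))
      -- The vertex `v` is common to all paths, so the path of index 0 suffices to identify it as a
      -- line.
      Y~v : ∃ λ M → v ≡ inj₂ M × Y 0F I M
      Y~v = neighbour-of-point (subst (λ y → Γ.Adj y v) (ys≡ 0F) (ys~v 0F))
      M : GeometryLine
      M = proj₁ Y~v
      v≡M : v ≡ inj₂ M
      v≡M = proj₁ (proj₂ Y~v)

    -- Reading the theta graph from its other end reduces this to a start at a point. The lines are
    -- now the second vertices of the paths, so injectivity is required of those.
    no-θ₃-from-line : ∀ M v (ys ls : Fin (suc t) → Γ.Vertex) →
      (∀ i → Γ.Adj (inj₂ M) (ys i)) → (∀ i → Γ.Adj (ys i) (ls i)) → (∀ i → Γ.Adj (ls i) v) →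
      (∀ {i j} → ls i Γ.≈ ls j → i ≡ j) →
      (∀ i → ¬ (inj₂ M Γ.≈ ls i)) → (∀ i → ¬ (ys i Γ.≈ v)) → ⊥
    no-θ₃-from-line M (inj₁ X) ys ls M~ys ys~ls ls~X ls-injective M≉ls ys≉X =
      no-θ₃-from-point X (inj₂ M) ls ys
        (λ i → Γ.Adj-sym (ls~X i)) (λ i → Γ.Adj-sym (ys~ls i)) (λ i → Γ.Adj-sym (M~ys i))
        ls-injective
        (λ i X≈y → ys≉X i (Γ.sym X≈y)) (λ i l≈M → M≉ls i (Γ.sym l≈M))
    no-θ₃-from-line M (inj₂ _) ys ls M~ys ys~ls ls~v _ _ _ =
      no-three-walk (M~ys 0F) (ys~ls 0F) (ls~v 0F)

    θ₃-free : ¬ (θ₃ (suc t) ⊑ Γ)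
    θ₃-free (f , adj) = from (to start) (λ i → adj {start} {first i} (fwd (start-first i)))
      (λ i eq → case injective {start} {second i} eq of λ ())
      where
      open Injection f using (to; injective)
      first~second : ∀ i → Γ.Adj (to (first i)) (to (second i))
      first~second i = adj {first i} {second i} (fwd (first-second i))
      second~end : ∀ i → Γ.Adj (to (second i)) (to end)
      second~end i = adj {second i} {end} (fwd (second-end i))
      first≉end : ∀ i → ¬ (to (first i) Γ.≈ to end)
      first≉end i eq = case injective {first i} {end} eq of λ ()
      first-injective : ∀ {i j} → to (first i) Γ.≈ to (first j) → i ≡ j
      first-injective {i} {j} eq = case injective {first i} {first j} eq of λ { refl → refl }
      second-injective : ∀ {i j} → to (second i) Γ.≈ to (second j) → i ≡ j
      second-injective {i} {j} eq = case injective {second i} {second j} eq of λ { refl → refl }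
      -- The image of `start` becomes a variable so that its side can be matched on.
      from : ∀ u → (∀ i → Γ.Adj u (to (first i))) → (∀ i → ¬ (u Γ.≈ to (second i))) → ⊥
      from (inj₁ X) u~first u≉second = no-θ₃-from-point X (to end) (to ∘ first) (to ∘ second)
        u~first first~second second~end (λ {i} {j} → first-injective {i} {j}) u≉second first≉end
      from (inj₂ M) u~first u≉second = no-θ₃-from-line M (to end) (to ∘ first) (to ∘ second)
        u~first first~second second~end (λ {i} {j} → second-injective {i} {j}) u≉second first≉end

theorem2p2 : ∀ {c ℓ s} (q n t : ℕ) .{{_ : NonZero n}} .{{_ : NonZero t}} →
    IsPrimePower q →
    (F : FiniteField q c ℓ) (ι : HyperplaneEmbedding F n) (S : PG.PointSet F n s) →
    (∀ (L : PG.Line F n) →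
    AtMost (PG.points F n) t (λ P → PG.PointSet.Member S P × P ⊆ L)) →
    LinearRepresentation.Γ F n ι S IsFree (C₄ ∷ θ₃ t ∷ [])
-- As `t` is nonzero it is a successor, which provides the path of index 0 used throughout.
theorem2p2 q n (suc t) _ F ι S S-lines = C₄-free ι S ∷ θ₃-free ι S S-lines ∷ []
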